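{- Let $n\ge m\ge 1$ be integers and $d\in\{l,r\}$. The algorithm $\mathrm{move}(n,m,d)$ described in the context performs only legal moves, transforms the initial configuration $b^nOw^m$ into the final configuration $w^mOb^n$, and uses exactly $nm+n+m$ moves; consequently it is optimal, i.e. no sequence of legal moves transforms the initial configuration into the final one with fewer moves.
   Context: The game: positions $1,\dots,n+m+1$ in a row, each holding a black checker ($b$), a white checker ($w$) or nothing, with exactly one empty position (the vacancy $O$). Initial configuration $b^nOw^m$, final configuration $w^mOb^n$. A legal move is a slide (a checker adjacent to the vacancy moves into it) or a jump (a checker at distance two from the vacancy jumps over the checker between them into it). Elementary operations: slide($l$): the checker immediately to the right of the vacancy slides left into it; slide($r$): the checker immediately to the left of the vacancy slides right into it; jump($l$): the checker two positions to the right of the vacancy jumps left into it; jump($r$): the checker two positions to the left of the vacancy jumps right into it; change($dir$) replaces $dir$ by the other element of $\{l,r\}$. The algorithm $\mathrm{move}(n,m,d)$: set $dir\gets d$. Stage 1: for $i=1,\dots,m$: perform jump($dir$) $i-1$ times, then slide($dir$), then change($dir$). Stage 2: perform jump($dir$) $m$ times. Stage 3: for $i=1,\dots,n-m$: perform slide($r$), then change($dir$), then jump($dir$) $m$ times. Stage 4: for $i=m,m-1,\dots,1$: perform change($dir$), then slide($dir$), then jump($dir$) $i-1$ times. -}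

module Defs where

open import Data.List using (List; []; _∷_; _++_; concatMap; downFrom; map; replicate; upTo)
open import Data.Nat using (ℕ; suc; _∸_)

data Colour : Set where
  b w : Colour

-- A row with exactly one vacancy: `xs O ys` lists, both from left to right,
-- the checkers before and after the vacancy.
record Config : Set where
  constructor _O_
  field
    before after : List Colour

infix 5 _O_

initial final : ℕ → ℕ → Config
initial n m = replicate n b O replicate m w
final   n m = replicate m w O replicate n b

data Dir : Set where
  l r : Dir

opposite : Dir → Dir
opposite l = r
opposite r = l

-- The direction is that of the moving checker, not of the vacancy.
data Op : Set where
  slide jump : Dir → Op

infix 4 _—[_]→_ _—[_]↠_

-- Legal moves.  Checkers of either colour may move in either direction, and a
-- jump may pass over a checker of either colour.
data _—[_]→_ : Config → Op → Config → Set where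
  slide-l : ∀ {xs c ys}   → xs O (c ∷ ys)            —[ slide l ]→ (xs ++ c ∷ []) O ys
  slide-r : ∀ {xs c ys}   → (xs ++ c ∷ []) O ys      —[ slide r ]→ xs O (c ∷ ys)
  jump-l  : ∀ {xs x c ys} → xs O (x ∷ c ∷ ys)        —[ jump l ]→  (xs ++ c ∷ x ∷ []) O ys
  jump-r  : ∀ {xs c x ys} → (xs ++ c ∷ x ∷ []) O ys  —[ jump r ]→  xs O (x ∷ c ∷ ys)

-- C —[ ops ]↠ C′ : the operations in ops, performed in order from C, are all
-- legal and end in C′.
data _—[_]↠_ : Config → List Op → Config → Set where
  done : ∀ {C} → C —[ [] ]↠ C
  step : ∀ {C D E op ops} → C —[ op ]→ D → D —[ ops ]↠ E → C —[ op ∷ ops ]↠ E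

-- Instructions of a program with one mutable variable dir.
data Instr : Set where
  slide-dir jump-dir change-dir : Instr
  slide-to : Dir → Instr

-- The operations performed when dir initially has the given value.
perform : Dir → List Instr → List Op
perform dir []               = []
perform dir (slide-dir ∷ p)  = slide dir ∷ perform dir p
perform dir (jump-dir ∷ p)   = jump dir ∷ perform dir p
perform dir (change-dir ∷ p) = perform (opposite dir) p
perform dir (slide-to e ∷ p) = slide e ∷ perform dir p

stage₁ stage₂ stage₄ : ℕ → List Instr
stage₃ : ℕ → ℕ → List Instr

-- i = 1, …, m
stage₁ m = concatMap (λ i → replicate (i ∸ 1) jump-dir ++ slide-dir ∷ change-dir ∷ [])
                     (map suc (upTo m))

stage₂ m = replicate m jump-dir

-- The body does not depend on the loop index.
stage₃ n m = concatMap (λ _ → slide-to r ∷ change-dir ∷ replicate m jump-dir)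
                       (upTo (n ∸ m))

-- i = m, m-1, …, 1
stage₄ m = concatMap (λ i → change-dir ∷ slide-dir ∷ replicate (i ∸ 1) jump-dir)
                     (map suc (downFrom m))

move : ℕ → ℕ → Dir → List Op
move n m d = perform d (stage₁ m ++ stage₂ m ++ stage₃ n m ++ stage₄ m)

{-# OPTIONS --safe #-}

-- Legality follows the shape of the row: between loops it is a monochromatic
-- block, an alternating block with the vacancy at one of its ends, and another
-- monochromatic block.
--
-- For optimality, slides and jumps are bounded separately.  A jump changes the
-- number of pairs "b somewhere before w" by at most one and a slide preserves
-- it, so at least n m jumps are needed.  For the slides, forget the vacancy and
-- let height u v, for a cut u | v of the remaining word, count the whites in u
-- and the blacks in v.  Adjacent cuts have heights of opposite parity; between
-- two slides the vacancy stays at cuts of one parity, and jumps alter the word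
-- only at cuts of the other parity.  As in odd-even transposition sort, after t
-- slides every cut whose height has the parity of t either still has no white
-- on its left or no black on its right, or has height at most t.  The vacancy
-- of the final row is at a cut of height m + n, whence t ≥ m + n.

module Submission where

open import Data.Empty using (⊥-elim)
open import Data.List using (List; []; _∷_; _++_; _∷ʳ_; concatMap; length; map; replicate; upTo; initLast; _∷ʳ′_)
open import Data.List.Properties using (++-assoc; ++-identityʳ; ∷-injective; ∷ʳ-++; concatMap-++; length-upTo; map-++; upTo-∷ʳ)
open import Data.Nat using (ℕ; zero; suc; _+_; _*_; _∸_; _≤_; _<_; z≤n; s≤s; parity)
open import Data.Nat.Properties using (+-assoc; +-comm; +-identityʳ; +-mono-≤; +-monoʳ-≤; +-suc; <⇒≱; m+[n∸m]≡n; m+n≡0⇒m≡0; m+n≡0⇒n≡0; *-zeroʳ; m+n∸m≡n; m≤n⇒m≤1+n; n≤1+n; ≤-refl; ≤-reflexive; ≤-trans; module ≤-Reasoning)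
open import Data.Nat.Tactic.RingSolver using (solve-∀)
open import Data.Parity using (Parity; 0ℙ)
open import Data.Product using (_×_; _,_; ∃-syntax)
open import Data.Sum using (_⊎_; inj₁; inj₂)
open import Relation.Binary.PropositionalEquality using (_≡_; _≢_; refl; sym; trans; cong; cong₂; subst; subst₂; module ≡-Reasoning)
open import Relation.Nullary using (¬_)
open import Defs

private
  variable
    C D E : Config
    d e f : Dir
    p q : List Instr
    ops : List Op

-- Execution of programs

-- Exec d C p e D : running p on C with dir = d ends in D with dir = e.
data Exec : Dir → Config → List Instr → Dir → Config → Set where
  stop     : Exec d C [] d C
  slide    : C —[ slide d ]→ D → Exec d D p e E → Exec d C (slide-dir ∷ p) e E
  jump     : C —[ jump d ]→ D → Exec d D p e E → Exec d C (jump-dir ∷ p) e E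
  change   : Exec (opposite d) C p e E → Exec d C (change-dir ∷ p) e E
  slide-to : C —[ slide f ]→ D → Exec d D p e E → Exec d C (slide-to f ∷ p) e E

exec⇒run : Exec d C p e D → C —[ perform d p ]↠ D
exec⇒run stop           = done
exec⇒run (slide s x)    = step s (exec⇒run x)
exec⇒run (jump s x)     = step s (exec⇒run x)
exec⇒run (change x)     = exec⇒run x
exec⇒run (slide-to s x) = step s (exec⇒run x)

infixr 5 _⨾_

_⨾_ : Exec d C p e D → Exec e D q f E → Exec d C (p ++ q) f E
stop         ⨾ y = y
slide s x    ⨾ y = slide s (x ⨾ y)
jump s x     ⨾ y = jump s (x ⨾ y)
change x     ⨾ y = change (x ⨾ y)
slide-to s x ⨾ y = slide-to s (x ⨾ y)

-- Alternating blocks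

pairs : Colour → Colour → ℕ → List Colour
pairs x c zero    = []
pairs x c (suc i) = x ∷ c ∷ pairs x c i

-- One alternating word bracketed in two ways: a slide at an end of the block re-pairs the checkers
-- that stay put.
pairs-shift : ∀ x c i ys → pairs x c i ++ x ∷ ys ≡ x ∷ pairs c x i ++ ys
pairs-shift x c zero    ys = refl
pairs-shift x c (suc i) ys = cong (λ zs → x ∷ c ∷ zs) (pairs-shift x c i ys)

pairs-suc : ∀ x c i ys → pairs x c (suc i) ++ ys ≡ pairs x c i ++ x ∷ c ∷ ys
pairs-suc x c zero    ys = refl
pairs-suc x c (suc i) ys = cong (λ zs → x ∷ c ∷ zs) (pairs-suc x c i ys)

replicate-shift : ∀ k (x : Colour) ys → replicate k x ++ x ∷ ys ≡ replicate (suc k) x ++ ys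
replicate-shift zero    x ys = refl
replicate-shift (suc k) x ys = cong (x ∷_) (replicate-shift k x ys)

replicate-∷ʳ : ∀ k (x : Colour) → replicate k x ∷ʳ x ≡ replicate (suc k) x
replicate-∷ʳ k x = trans (replicate-shift k x []) (++-identityʳ _)

-- The vacancy is at the end of mid from which checkers jump over mid in
-- direction d.
place : Dir → List Colour → List Colour → List Colour → Config
place l xs mid ys = xs O (mid ++ ys)
place r xs mid ys = (xs ++ mid) O ys

place-[] : ∀ d xs ys → place d xs [] ys ≡ (xs O ys)
place-[] l xs ys = refl
place-[] r xs ys = cong (_O ys) (++-identityʳ xs)

-- Each jump exchanges the pair next to the vacancy and carries the vacancy past it. For `r` the
-- pairs are consumed from the right, hence `pairs-suc`.
jumps : ∀ d x c i xs ys →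
  Exec d (place d xs (pairs x c i) ys) (replicate i jump-dir)
       d (place (opposite d) xs (pairs c x i) ys)
jumps d x c zero    xs ys rewrite place-[] d xs ys | place-[] (opposite d) xs ys = stop
jumps l x c (suc i) xs ys =
  jump jump-l (subst (λ zs → Exec l ((xs ++ c ∷ x ∷ []) O (pairs x c i ++ ys)) (replicate i jump-dir) l (zs O ys))
    (++-assoc xs (c ∷ x ∷ []) (pairs c x i))
    (jumps l x c i (xs ++ c ∷ x ∷ []) ys))
jumps r x c (suc i) xs ys =
  subst₂ (λ us vs → Exec r (us O ys) (replicate (suc i) jump-dir) r (xs O vs))
    before≡ (sym (pairs-suc c x i ys))
    (jump jump-r (jumps r x c i xs (c ∷ x ∷ ys)))
  where
  before≡ : (xs ++ pairs x c i) ++ x ∷ c ∷ [] ≡ xs ++ pairs x c (suc i)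
  before≡ = trans (++-assoc xs _ _)
    (cong (xs ++_) (trans (sym (pairs-suc x c i [])) (++-identityʳ _)))

-- Equations stand in for the endpoints, since the blocks match `xs ∷ʳ c` only after reassociation.
slide-l-≡ : ∀ {xs c ys us vs} → xs ∷ʳ c ≡ us → ys ≡ vs → xs O (c ∷ ys) —[ slide l ]→ us O vs
slide-l-≡ refl refl = slide-l

slide-r-≡ : ∀ {xs c ys us vs} → xs ∷ʳ c ≡ us → c ∷ ys ≡ vs → us O ys —[ slide r ]→ xs O vs
slide-r-≡ refl refl = slide-r

-- The block gains a black on its left and a white on its right: one of them slides across the
-- vacancy, the other joins by re-pairing.
slide-widen : ∀ d p i q →
  place (opposite d) (replicate (suc p) b) (pairs w b i) (replicate (suc q) w)
    —[ slide d ]→ place (opposite d) (replicate p b) (pairs b w (suc i)) (replicate q w)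
slide-widen l p i q = slide-l-≡ (begin
  (replicate (suc p) b ++ pairs w b i) ∷ʳ w  ≡⟨ ++-assoc (replicate (suc p) b) _ _ ⟩
  replicate (suc p) b ++ pairs w b i ∷ʳ w    ≡⟨ replicate-shift p b _ ⟨
  replicate p b ++ b ∷ pairs w b i ∷ʳ w      ≡⟨ cong (λ zs → replicate p b ++ b ∷ zs) (pairs-shift w b i []) ⟩
  replicate p b ++ b ∷ w ∷ pairs b w i ++ [] ≡⟨ cong (replicate p b ++_) (++-identityʳ _) ⟩
  replicate p b ++ pairs b w (suc i)         ∎) refl
  where open ≡-Reasoning
slide-widen r p i q =
  slide-r-≡ (replicate-∷ʳ p b) (cong (b ∷_) (pairs-shift w b i (replicate q w)))

-- The checker left of the vacancy is black at either end of the block, so `slide r` serves both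
-- values of `d`.
slide-shift : ∀ d p i q →
  place d (replicate (suc p) b) (pairs w b i) (replicate q b)
    —[ slide r ]→ place d (replicate p b) (pairs b w i) (replicate (suc q) b)
slide-shift l p i q =
  slide-r-≡ (replicate-∷ʳ p b) (sym (pairs-shift b w i (replicate q b)))
slide-shift r p i q = slide-r-≡ (begin
  (replicate p b ++ pairs b w i) ∷ʳ b      ≡⟨ ++-assoc (replicate p b) _ _ ⟩
  replicate p b ++ pairs b w i ∷ʳ b        ≡⟨ cong (replicate p b ++_) (pairs-shift b w i []) ⟩
  replicate p b ++ b ∷ pairs w b i ++ []   ≡⟨ cong (λ zs → replicate p b ++ b ∷ zs) (++-identityʳ _) ⟩
  replicate p b ++ b ∷ pairs w b i         ≡⟨ replicate-shift p b _ ⟩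
  replicate (suc p) b ++ pairs w b i       ∎) refl
  where open ≡-Reasoning

-- The reverse of widening: the outermost white and black join the final blocks, one by sliding and
-- one by re-pairing.
slide-narrow : ∀ d p i q →
  place d (replicate p w) (pairs w b (suc i)) (replicate q b)
    —[ slide d ]→ place d (replicate (suc p) w) (pairs b w i) (replicate (suc q) b)
slide-narrow l p i q =
  slide-l-≡ (replicate-∷ʳ p w) (sym (pairs-shift b w i (replicate q b)))
slide-narrow r p i q = slide-r-≡ (begin
  (replicate (suc p) w ++ pairs b w i) ∷ʳ b    ≡⟨ ++-assoc (replicate (suc p) w) _ _ ⟩
  replicate (suc p) w ++ pairs b w i ∷ʳ b      ≡⟨ replicate-shift p w _ ⟨
  replicate p w ++ w ∷ pairs b w i ∷ʳ b        ≡⟨ cong (λ zs → replicate p w ++ w ∷ zs) (pairs-shift b w i []) ⟩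
  replicate p w ++ w ∷ b ∷ pairs w b i ++ []   ≡⟨ cong (replicate p w ++_) (++-identityʳ _) ⟩
  replicate p w ++ pairs w b (suc i)           ∎) refl
  where open ≡-Reasoning

-- The four stages

-- `upTo` grows at its end, so the last pass is split off; for `stage₄` the first pass splits off by
-- computation.
stage₁-suc : ∀ m → stage₁ (suc m) ≡ stage₁ m ++ replicate m jump-dir ++ slide-dir ∷ change-dir ∷ []
stage₁-suc m = begin
  concatMap body (map suc (upTo (suc m)))                    ≡⟨ cong (λ is → concatMap body (map suc is)) (upTo-∷ʳ m) ⟨
  concatMap body (map suc (upTo m ∷ʳ m))                     ≡⟨ cong (concatMap body) (map-++ suc (upTo m) (m ∷ [])) ⟩
  concatMap body (map suc (upTo m) ∷ʳ suc m)                 ≡⟨ concatMap-++ body (map suc (upTo m)) (suc m ∷ []) ⟩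
  stage₁ m ++ body (suc m) ++ []                             ≡⟨ cong (stage₁ m ++_) (++-identityʳ _) ⟩
  stage₁ m ++ replicate m jump-dir ++ slide-dir ∷ change-dir ∷ [] ∎
  where
  open ≡-Reasoning
  body : ℕ → List Instr
  body i = replicate (i ∸ 1) jump-dir ++ slide-dir ∷ change-dir ∷ []

-- The direction reached alternates with `i`, hence the existential; the vacancy is always at the
-- end from which that direction jumps.
exec-stage₁ : ∀ d i p q →
  ∃[ e ] Exec d (initial (i + p) (i + q)) (stage₁ i)
              e (place e (replicate p b) (pairs b w i) (replicate q w))
exec-stage₁ d zero    p q = d , subst (Exec d _ [] d) (sym (place-[] d _ _)) stop
exec-stage₁ d (suc i) p q
  with exec-stage₁ d i (suc p) (suc q)
... | e , x rewrite stage₁-suc i | +-suc i p | +-suc i q = opposite e ,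
  (x ⨾ jumps e b w i _ _ ⨾ slide (slide-widen e p i q) (change stop))

-- Stated for any list, because only the number of passes matters and `upTo` is not suited to
-- structural recursion.
exec-stage₃ : ∀ {A : Set} d m (is : List A) q →
  ∃[ e ] Exec d (place (opposite d) (replicate (length is) b) (pairs w b m) (replicate q b))
              (concatMap (λ _ → slide-to r ∷ change-dir ∷ replicate m jump-dir) is)
              e (place (opposite e) [] (pairs w b m) (replicate (length is + q) b))
exec-stage₃ d m []       q = d , stop
exec-stage₃ d m (_ ∷ is) q
  with exec-stage₃ (opposite d) m is (suc q)
... | e , x rewrite +-suc (length is) q = e ,
  slide-to (slide-shift (opposite d) (length is) m q)
    (change (jumps (opposite d) b w m _ _ ⨾ x))

exec-stage₄ : ∀ d i p q →
  ∃[ e ] Exec d (place (opposite d) (replicate p w) (pairs w b i) (replicate q b))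
              (stage₄ i)
              e (final (i + q) (i + p))
exec-stage₄ d zero    p q = d , subst (λ C → Exec d C [] d (final q p)) (sym (place-[] (opposite d) _ _)) stop
exec-stage₄ d (suc i) p q
  with exec-stage₄ (opposite d) i (suc p) (suc q)
... | e , x rewrite +-suc i p | +-suc i q = e ,
  change (slide (slide-narrow (opposite d) p i q) (jumps (opposite d) b w i _ _ ⨾ x))

move-legal : ∀ m k d → initial (m + k) m —[ move (m + k) m d ]↠ final (m + k) m
move-legal m k d
  -- With `k` for `n ∸ m`, stage 1 absorbs all whites and leaves `k` blacks outside the block, one
  -- for each pass of stage 3.
  with exec-stage₁ d m k 0
... | e₁ , x₁
  with exec-stage₃ e₁ m (upTo k) 0
... | e₃ , x₃
  with exec-stage₄ e₃ m 0 k
... | e₄ , x₄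
  rewrite m+n∸m≡n m k | length-upTo k | +-identityʳ k | +-identityʳ m =
  exec⇒run (x₁ ⨾ jumps e₁ b w m _ _ ⨾ x₃ ⨾ x₄)

-- The number of moves

cost : List Instr → ℕ
cost []               = 0
cost (slide-dir ∷ p)  = suc (cost p)
cost (jump-dir ∷ p)   = suc (cost p)
cost (change-dir ∷ p) = cost p
cost (slide-to _ ∷ p) = suc (cost p)

length-perform : ∀ d p → length (perform d p) ≡ cost p
length-perform d []               = refl
length-perform d (slide-dir ∷ p)  = cong suc (length-perform d p)
length-perform d (jump-dir ∷ p)   = cong suc (length-perform d p)
length-perform d (change-dir ∷ p) = length-perform (opposite d) p
length-perform d (slide-to _ ∷ p) = cong suc (length-perform d p)

cost-++ : ∀ p q → cost (p ++ q) ≡ cost p + cost q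
cost-++ []               q = refl
cost-++ (slide-dir ∷ p)  q = cong suc (cost-++ p q)
cost-++ (jump-dir ∷ p)   q = cong suc (cost-++ p q)
cost-++ (change-dir ∷ p) q = cost-++ p q
cost-++ (slide-to _ ∷ p) q = cong suc (cost-++ p q)

cost-jumps : ∀ k → cost (replicate k jump-dir) ≡ k
cost-jumps zero    = refl
cost-jumps (suc k) = cong suc (cost-jumps k)

cost-stage₁-suc : ∀ m → cost (stage₁ (suc m)) ≡ cost (stage₁ m) + (m + 1)
cost-stage₁-suc m = begin
  cost (stage₁ (suc m))                                        ≡⟨ cong cost (stage₁-suc m) ⟩
  cost (stage₁ m ++ replicate m jump-dir ++ _)                 ≡⟨ cost-++ (stage₁ m) _ ⟩
  cost (stage₁ m) + cost (replicate m jump-dir ++ _)           ≡⟨ cong (cost (stage₁ m) +_) (cost-++ (replicate m jump-dir) _) ⟩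
  cost (stage₁ m) + (cost (replicate m jump-dir) + 1)          ≡⟨ cong (λ k → cost (stage₁ m) + (k + 1)) (cost-jumps m) ⟩
  cost (stage₁ m) + (m + 1)                                    ∎
  where open ≡-Reasoning

cost-stage₄-suc : ∀ m → cost (stage₄ (suc m)) ≡ suc (m + cost (stage₄ m))
cost-stage₄-suc m = cong suc (trans (cost-++ (replicate m jump-dir) _)
  (cong (_+ cost (stage₄ m)) (cost-jumps m)))

-- Each of the two stages costs a triangular number; adding them avoids the division by two.
cost-stage₁₄ : ∀ m → cost (stage₁ m) + cost (stage₄ m) ≡ m * m + m
cost-stage₁₄ zero    = refl
cost-stage₁₄ (suc m) = begin
  cost (stage₁ (suc m)) + cost (stage₄ (suc m))                 ≡⟨ cong₂ _+_ (cost-stage₁-suc m) (cost-stage₄-suc m) ⟩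
  (cost (stage₁ m) + (m + 1)) + suc (m + cost (stage₄ m))       ≡⟨ regroup (cost (stage₁ m)) (cost (stage₄ m)) m ⟩
  (cost (stage₁ m) + cost (stage₄ m)) + (m + m + 2)             ≡⟨ cong (_+ (m + m + 2)) (cost-stage₁₄ m) ⟩
  (m * m + m) + (m + m + 2)                                     ≡⟨ expand m ⟩
  suc m * suc m + suc m                                         ∎
  where
  open ≡-Reasoning
  regroup : ∀ x y m → (x + (m + 1)) + suc (m + y) ≡ (x + y) + (m + m + 2)
  regroup = solve-∀
  expand : ∀ m → (m * m + m) + (m + m + 2) ≡ suc m * suc m + suc m
  expand = solve-∀

cost-stage₃ : ∀ {A : Set} m (is : List A) →
  cost (concatMap (λ _ → slide-to r ∷ change-dir ∷ replicate m jump-dir) is) ≡ length is * suc m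
cost-stage₃ m []       = refl
cost-stage₃ m (_ ∷ is) = cong suc (trans (cost-++ (replicate m jump-dir) _)
  (cong₂ _+_ (cost-jumps m) (cost-stage₃ m is)))

length-move : ∀ m k d → length (move (m + k) m d) ≡ (m + k) * m + (m + k) + m
length-move m k d rewrite m+n∸m≡n m k = begin
  length (perform d (stage₁ m ++ stage₂ m ++ s₃ ++ stage₄ m))       ≡⟨ length-perform d (stage₁ m ++ stage₂ m ++ s₃ ++ stage₄ m) ⟩
  cost (stage₁ m ++ stage₂ m ++ s₃ ++ stage₄ m)                     ≡⟨ cost-++ (stage₁ m) _ ⟩
  c₁ + cost (stage₂ m ++ s₃ ++ stage₄ m)                            ≡⟨ cong (c₁ +_) (cost-++ (stage₂ m) _) ⟩
  c₁ + (cost (stage₂ m) + cost (s₃ ++ stage₄ m))                    ≡⟨ cong (λ k → c₁ + (cost (stage₂ m) + k)) (cost-++ s₃ _) ⟩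
  c₁ + (cost (stage₂ m) + (cost s₃ + c₄))                           ≡⟨ cong₂ (λ x y → c₁ + (x + (y + c₄))) (cost-jumps m) s₃≡ ⟩
  c₁ + (m + (k * suc m + c₄))                                       ≡⟨ regroup c₁ c₄ m (k * suc m) ⟩
  (c₁ + c₄) + (m + k * suc m)                                       ≡⟨ cong (_+ (m + k * suc m)) (cost-stage₁₄ m) ⟩
  (m * m + m) + (m + k * suc m)                                     ≡⟨ expand m k ⟩
  (m + k) * m + (m + k) + m                                         ∎
  where
  open ≡-Reasoning
  c₁ c₄ : ℕ
  c₁ = cost (stage₁ m)
  c₄ = cost (stage₄ m)
  s₃ : List Instr
  s₃ = concatMap (λ _ → slide-to r ∷ change-dir ∷ replicate m jump-dir) (upTo k)
  s₃≡ : cost s₃ ≡ k * suc m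
  s₃≡ = trans (cost-stage₃ m (upTo k)) (cong (_* suc m) (length-upTo k))
  regroup : ∀ x y m z → x + (m + (z + y)) ≡ (x + y) + (m + z)
  regroup = solve-∀
  expand : ∀ m k → (m * m + m) + (m + k * suc m) ≡ (m + k) * m + (m + k) + m
  expand = solve-∀

-- Jumps and inversions

whites blacks inversions : List Colour → ℕ
whites []       = 0
whites (b ∷ xs) = whites xs
whites (w ∷ xs) = suc (whites xs)
blacks []       = 0
blacks (b ∷ xs) = suc (blacks xs)
blacks (w ∷ xs) = blacks xs
inversions []       = 0
inversions (b ∷ xs) = whites xs + inversions xs
inversions (w ∷ xs) = inversions xs

whites-++ : ∀ xs ys → whites (xs ++ ys) ≡ whites xs + whites ys
whites-++ []       ys = refl
whites-++ (b ∷ xs) ys = whites-++ xs ys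
whites-++ (w ∷ xs) ys = cong suc (whites-++ xs ys)

blacks-++ : ∀ xs ys → blacks (xs ++ ys) ≡ blacks xs + blacks ys
blacks-++ []       ys = refl
blacks-++ (b ∷ xs) ys = cong suc (blacks-++ xs ys)
blacks-++ (w ∷ xs) ys = blacks-++ xs ys

whites-swap : ∀ xs x c ys → whites (xs ++ x ∷ c ∷ ys) ≡ whites (xs ++ c ∷ x ∷ ys)
whites-swap []       b b ys = refl
whites-swap []       b w ys = refl
whites-swap []       w b ys = refl
whites-swap []       w w ys = refl
whites-swap (b ∷ xs) x c ys = whites-swap xs x c ys
whites-swap (w ∷ xs) x c ys = cong suc (whites-swap xs x c ys)

blacks-swap : ∀ xs x c ys → blacks (xs ++ x ∷ c ∷ ys) ≡ blacks (xs ++ c ∷ x ∷ ys)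
blacks-swap []       b b ys = refl
blacks-swap []       b w ys = refl
blacks-swap []       w b ys = refl
blacks-swap []       w w ys = refl
blacks-swap (b ∷ xs) x c ys = cong suc (blacks-swap xs x c ys)
blacks-swap (w ∷ xs) x c ys = blacks-swap xs x c ys

-- Only the exchanged pair itself can change its contribution: an earlier black still sees the same
-- number of whites.
inversions-swap : ∀ xs x c ys →
  inversions (xs ++ x ∷ c ∷ ys) ≤ suc (inversions (xs ++ c ∷ x ∷ ys))
inversions-swap []       b b ys = n≤1+n _
inversions-swap []       b w ys = ≤-refl
inversions-swap []       w b ys = m≤n⇒m≤1+n (n≤1+n _)
inversions-swap []       w w ys = n≤1+n _
inversions-swap (w ∷ xs) x c ys = inversions-swap xs x c ys
inversions-swap (b ∷ xs) x c ys = ≤-trans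
  (+-mono-≤ (≤-reflexive (whites-swap xs x c ys)) (inversions-swap xs x c ys))
  (≤-reflexive (+-suc _ _))

whites-replicate-w : ∀ m → whites (replicate m w) ≡ m
whites-replicate-w zero    = refl
whites-replicate-w (suc m) = cong suc (whites-replicate-w m)

whites-replicate-b : ∀ n → whites (replicate n b) ≡ 0
whites-replicate-b zero    = refl
whites-replicate-b (suc n) = whites-replicate-b n

blacks-replicate-b : ∀ n → blacks (replicate n b) ≡ n
blacks-replicate-b zero    = refl
blacks-replicate-b (suc n) = cong suc (blacks-replicate-b n)

blacks-replicate-w : ∀ m → blacks (replicate m w) ≡ 0
blacks-replicate-w zero    = refl
blacks-replicate-w (suc m) = blacks-replicate-w m

inversions-replicate-w : ∀ m → inversions (replicate m w) ≡ 0
inversions-replicate-w zero    = refl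
inversions-replicate-w (suc m) = inversions-replicate-w m

inversions-replicate-b : ∀ n ys → inversions (replicate n b ++ ys) ≡ n * whites ys + inversions ys
inversions-replicate-b zero    ys = refl
inversions-replicate-b (suc n) ys
  rewrite whites-++ (replicate n b) ys | whites-replicate-b n | inversions-replicate-b n ys =
  sym (+-assoc (whites ys) _ _)

inversions-initial : ∀ n m → inversions (replicate n b ++ replicate m w) ≡ n * m
inversions-initial n m
  rewrite inversions-replicate-b n (replicate m w) | whites-replicate-w m | inversions-replicate-w m =
  +-identityʳ _

-- Slides and heights of cuts

height : List Colour → List Colour → ℕ
height u v = whites u + blacks v

-- Equal to `0ℙ` when the height has the parity of `t`.
phase : ℕ → List Colour → List Colour → Parity
phase t u v = parity (t + height u v)

height-∷ʳ-b : ∀ u v → height u (b ∷ v) ≡ suc (height (u ∷ʳ b) v)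
height-∷ʳ-b u v rewrite whites-++ u (b ∷ []) | +-identityʳ (whites u) = +-suc _ _

height-∷ʳ-w : ∀ u v → height (u ∷ʳ w) v ≡ suc (height u (w ∷ v))
height-∷ʳ-w u v rewrite whites-++ u (w ∷ []) | +-comm (whites u) 1 = refl

-- Passing a white raises the height by one and passing a black lowers it by one, so either flips
-- the parity, as one more slide does.
phase-∷ʳ : ∀ t u a v → phase t (u ∷ʳ a) v ≡ phase (suc t) u (a ∷ v)
phase-∷ʳ t u b v rewrite height-∷ʳ-b u v | +-suc t (height (u ∷ʳ b) v) = refl
phase-∷ʳ t u w v rewrite height-∷ʳ-w u v | +-suc t (height u (w ∷ v)) = refl

phase-∷ʳ-∷ʳ : ∀ t u c x v → phase t (u ++ c ∷ x ∷ []) v ≡ phase t u (x ∷ c ∷ v)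
phase-∷ʳ-∷ʳ t u c x v = begin
  phase t (u ++ c ∷ x ∷ []) v    ≡⟨ cong (λ z → phase t z v) (∷ʳ-++ u c (x ∷ [])) ⟨
  phase t (u ∷ʳ c ∷ʳ x) v        ≡⟨ phase-∷ʳ t (u ∷ʳ c) x v ⟩
  -- `parity` recurses by two, so `phase (suc (suc t))` is `phase t` by computation.
  phase (suc t) (u ∷ʳ c) (x ∷ v) ≡⟨ phase-∷ʳ (suc t) u c (x ∷ v) ⟩
  phase t u (c ∷ x ∷ v)          ≡⟨ cong (λ k → parity (t + (whites u + k))) (blacks-swap [] c x v) ⟩
  phase t u (x ∷ c ∷ v)          ∎
  where open ≡-Reasoning

parity-suc : ∀ k → parity (suc k) ≡ 0ℙ → parity k ≢ 0ℙ
parity-suc (suc (suc k)) p q = parity-suc k p q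

-- Takes the two counts rather than the cut, so that equalities of counts transport it.
Tame : ℕ → ℕ → ℕ → Set
Tame t whitesˡ blacksʳ = whitesˡ ≡ 0 ⊎ blacksʳ ≡ 0 ⊎ whitesˡ + blacksʳ ≤ t

TameCuts : ℕ → List Colour → Set
TameCuts t xs = ∀ u v → u ++ v ≡ xs → phase t u v ≡ 0ℙ → Tame t (whites u) (blacks v)

compare-cuts : ∀ (u v xs ys : List Colour) → u ++ v ≡ xs ++ ys →
  (∃[ zs ] xs ≡ u ++ zs × v ≡ zs ++ ys) ⊎
  (∃[ z ] ∃[ zs ] u ≡ xs ++ z ∷ zs × ys ≡ z ∷ zs ++ v)
compare-cuts []      v xs       ys eq = inj₁ (xs , refl , eq)
compare-cuts (a ∷ u) v []       ys eq = inj₂ (a , u , refl , sym eq)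
compare-cuts (a ∷ u) v (x ∷ xs) ys eq with ∷-injective eq
... | refl , eq′ with compare-cuts u v xs ys eq′
... | inj₁ (zs , refl , q)     = inj₁ (zs , refl , q)
... | inj₂ (z , zs , refl , q) = inj₂ (z , zs , refl , q)

-- Only the cut between the exchanged checkers can change its counts, and it is adjacent to a cut in
-- phase, hence out of phase itself.
tameCuts-swap : ∀ t xs x c ys → phase t xs (x ∷ c ∷ ys) ≡ 0ℙ →
  TameCuts t (xs ++ x ∷ c ∷ ys) → TameCuts t (xs ++ c ∷ x ∷ ys)
tameCuts-swap t xs x c ys ph tame u v eq ph′ with compare-cuts u v xs (c ∷ x ∷ ys) eq
... | inj₁ (zs , refl , refl) =
  subst (Tame t (whites u)) (blacks-swap zs x c ys)
    (tame u (zs ++ x ∷ c ∷ ys) (sym (++-assoc u zs _))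
      (trans (cong (λ k → parity (t + (whites u + k))) (blacks-swap zs x c ys)) ph′))
... | inj₂ (_ , [] , refl , refl) =
  ⊥-elim (parity-suc (t + height xs (c ∷ x ∷ ys))
    (trans (sym (phase-∷ʳ t xs c (x ∷ ys))) ph′)
    (trans (cong (λ k → parity (t + (whites xs + k))) (blacks-swap [] c x ys)) ph))
... | inj₂ (_ , _ ∷ zs , refl , refl) =
  subst (λ k → Tame t k (blacks v)) (whites-swap xs x c zs)
    (tame (xs ++ x ∷ c ∷ zs) v (++-assoc xs _ v)
      (trans (cong (λ k → parity (t + (k + blacks v))) (whites-swap xs x c zs)) ph′))

1≤odd : ∀ t → parity (t + 1) ≡ 0ℙ → 1 ≤ t
1≤odd (suc t) _ = s≤s z≤n

whites-∷ʳ-b : ∀ u → whites (u ∷ʳ b) ≡ whites u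
whites-∷ʳ-b u = trans (whites-++ u _) (+-identityʳ _)

whites-∷ʳ-w : ∀ u → whites (u ∷ʳ w) ≡ suc (whites u)
whites-∷ʳ-w u = trans (whites-++ u _) (+-comm _ 1)

-- A cut u a | c v entering the phase is compared with its neighbours, which were
-- in the previous one.  If a = w, c = b and both neighbours have a one-coloured
-- side, then the cut has height 2 and the parity of the neighbours gives t ≥ 1.
tame-suc : ∀ t u a c v → phase t u (a ∷ c ∷ v) ≡ 0ℙ →
  Tame t (whites u) (blacks (a ∷ c ∷ v)) →
  Tame t (whites (u ∷ʳ a ∷ʳ c)) (blacks v) →
  Tame (suc t) (whites (u ∷ʳ a)) (blacks (c ∷ v))
tame-suc t u b c v ph left right rewrite whites-∷ʳ-b u with left
... | inj₁ k≡0        = inj₁ k≡0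
... | inj₂ (inj₂ k≤t) = inj₂ (inj₂ (m≤n⇒m≤1+n (≤-trans (+-monoʳ-≤ (whites u) (n≤1+n _)) k≤t)))
tame-suc t u w w v ph left right rewrite whites-∷ʳ-w (u ∷ʳ w) with right
... | inj₂ (inj₁ k≡0) = inj₂ (inj₁ k≡0)
... | inj₂ (inj₂ k≤t) = inj₂ (inj₂ (m≤n⇒m≤1+n (≤-trans (n≤1+n _) k≤t)))
tame-suc t u w b v ph left right
  rewrite whites-∷ʳ-b (u ∷ʳ w) | whites-∷ʳ-w u with left | right
... | inj₂ (inj₂ k≤t) | _               = inj₂ (inj₂ (s≤s k≤t))
... | inj₁ _          | inj₂ (inj₂ k≤t) = inj₂ (inj₂ (s≤s (≤-trans (≤-reflexive (+-suc (whites u) _)) k≤t)))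
... | inj₁ k≡0        | inj₂ (inj₁ j≡0) rewrite k≡0 | j≡0 = inj₂ (inj₂ (s≤s (1≤odd t ph)))

-- A cut in phase at `suc t` has neighbours in phase at `t`. At either end of the row a neighbour is
-- missing, but there one side is empty.
tameCuts-suc : ∀ t xs → TameCuts t xs → TameCuts (suc t) xs
tameCuts-suc t xs tame u v eq ph with initLast u
tameCuts-suc t xs tame u v       eq ph | []       = inj₁ refl
tameCuts-suc t xs tame u []      eq ph | u′ ∷ʳ′ a = inj₂ (inj₁ refl)
tameCuts-suc t xs tame u (c ∷ v) eq ph | u′ ∷ʳ′ a =
  tame-suc t u′ a c v left-phase
    (tame u′ (a ∷ c ∷ v) (trans (sym (∷ʳ-++ u′ a (c ∷ v))) eq) left-phase)
    (tame (u′ ∷ʳ a ∷ʳ c) v (trans (∷ʳ-++ (u′ ∷ʳ a) c v) eq)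
      (trans (phase-∷ʳ t (u′ ∷ʳ a) c v) ph))
  where
  left-phase : phase t u′ (a ∷ c ∷ v) ≡ 0ℙ
  left-phase = trans (sym (phase-∷ʳ (suc t) u′ a (c ∷ v))) ph

-- Every cut has only blacks on its left or only whites on its right.
tameCuts-initial : ∀ n m → TameCuts 0 (replicate n b ++ replicate m w)
tameCuts-initial n m u v eq _ with compare-cuts u v (replicate n b) (replicate m w) eq
... | inj₁ (zs , bs≡ , _) = inj₁ (m+n≡0⇒m≡0 (whites u)
  (trans (sym (whites-++ u zs)) (trans (cong whites (sym bs≡)) (whites-replicate-b n))))
... | inj₂ (z , zs , _ , ws≡) = inj₂ (inj₁ (m+n≡0⇒n≡0 (blacks (z ∷ zs))
  (trans (sym (blacks-++ (z ∷ zs) v)) (trans (cong blacks (sym ws≡)) (blacks-replicate-w m)))))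

-- Optimality

-- Invariant of a row that has been reached with exactly t slides.
Slid : ℕ → Config → Set
Slid t (xs O ys) = TameCuts t (xs ++ ys) × phase t xs ys ≡ 0ℙ

slid-slide : ∀ {t} → C —[ slide d ]→ D → Slid t C → Slid (suc t) D
slid-slide {t = t} (slide-l {xs} {c} {ys}) (tame , ph) =
  subst (TameCuts (suc t)) (sym (∷ʳ-++ xs c ys)) (tameCuts-suc t _ tame) ,
  trans (phase-∷ʳ (suc t) xs c ys) ph
slid-slide {t = t} (slide-r {xs} {c} {ys}) (tame , ph) =
  subst (TameCuts (suc t)) (∷ʳ-++ xs c ys) (tameCuts-suc t _ tame) ,
  trans (sym (phase-∷ʳ t xs c ys)) ph

slid-jump : ∀ {t} → C —[ jump d ]→ D → Slid t C → Slid t D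
slid-jump {t = t} (jump-l {xs} {x} {c} {ys}) (tame , ph) =
  subst (TameCuts t) (sym (++-assoc xs (c ∷ x ∷ []) ys)) (tameCuts-swap t xs x c ys ph tame) ,
  trans (phase-∷ʳ-∷ʳ t xs c x ys) ph
slid-jump {t = t} (jump-r {xs} {c} {x} {ys}) (tame , ph) =
  -- The exchange is viewed from `xs`, the cut where the vacancy lands, which has the same phase as
  -- the cut it left.
  tameCuts-swap t xs c x ys
    (trans (cong (λ k → parity (t + (whites xs + k))) (blacks-swap [] c x ys)) ph′)
    (subst (TameCuts t) (++-assoc xs (c ∷ x ∷ []) ys) tame) ,
  ph′
  where
  ph′ : phase t xs (x ∷ c ∷ ys) ≡ 0ℙ
  ph′ = trans (sym (phase-∷ʳ-∷ʳ t xs c x ys)) ph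

slid-final : ∀ {t} n m → Slid t (final (suc n) (suc m)) → suc m + suc n ≤ t
-- At the vacancy there are whites on the left and blacks on the right, so only the bound on the
-- height remains.
slid-final n m (tame , ph) with tame (replicate (suc m) w) (replicate (suc n) b) refl ph
... | inj₂ (inj₂ h≤t) rewrite whites-replicate-w m | blacks-replicate-b n = h≤t

inversionsᶜ : Config → ℕ
inversionsᶜ (xs O ys) = inversions (xs ++ ys)

inversions-slide : C —[ slide d ]→ D → inversionsᶜ C ≡ inversionsᶜ D
inversions-slide (slide-l {xs} {c} {ys}) = cong inversions (sym (∷ʳ-++ xs c ys))
inversions-slide (slide-r {xs} {c} {ys}) = cong inversions (∷ʳ-++ xs c ys)

inversions-jump : C —[ jump d ]→ D → inversionsᶜ C ≤ suc (inversionsᶜ D)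
inversions-jump (jump-l {xs} {x} {c} {ys})
  rewrite ++-assoc xs (c ∷ x ∷ []) ys = inversions-swap xs x c ys
inversions-jump (jump-r {xs} {c} {x} {ys})
  rewrite ++-assoc xs (c ∷ x ∷ []) ys = inversions-swap xs c x ys

inversions-final : ∀ n m → inversionsᶜ (final n m) ≡ 0
inversions-final n zero    = trans (cong inversions (sym (++-identityʳ (replicate n b))))
  (trans (inversions-replicate-b n []) (trans (+-identityʳ _) (*-zeroʳ n)))
inversions-final n (suc m) = inversions-final n m

-- A slide raises `t` and keeps the inversions; a jump keeps `t` and removes at most one inversion.
-- So each operation pays for at most one unit.
run-bound : ∀ {t} n m → Slid t C → C —[ ops ]↠ final (suc n) (suc m) →
  (suc m + suc n) + inversionsᶜ C ≤ length ops + t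
run-bound {t = t} n m slid done = begin
  (suc m + suc n) + inversionsᶜ (final (suc n) (suc m)) ≡⟨ cong (suc m + suc n +_) (inversions-final (suc n) (suc m)) ⟩
  (suc m + suc n) + 0                                   ≡⟨ +-identityʳ _ ⟩
  suc m + suc n                                         ≤⟨ slid-final n m slid ⟩
  t                                                     ∎
  where open ≤-Reasoning
run-bound {C} {t = t} n m slid (step {D = D} {op = slide _} {ops = ops} s run) = begin
  (suc m + suc n) + inversionsᶜ C ≡⟨ cong (suc m + suc n +_) (inversions-slide s) ⟩
  (suc m + suc n) + inversionsᶜ D ≤⟨ run-bound n m (slid-slide s slid) run ⟩
  length ops + suc t              ≡⟨ +-suc _ t ⟩
  suc (length ops) + t            ∎
  where open ≤-Reasoning
run-bound {C} {t = t} n m slid (step {D = D} {op = jump _} {ops = ops} s run) = begin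
  (suc m + suc n) + inversionsᶜ C       ≤⟨ +-monoʳ-≤ (suc m + suc n) (inversions-jump s) ⟩
  (suc m + suc n) + suc (inversionsᶜ D) ≡⟨ +-suc (suc m + suc n) _ ⟩
  suc ((suc m + suc n) + inversionsᶜ D) ≤⟨ s≤s (run-bound n m (slid-jump s slid) run) ⟩
  suc (length ops) + t                  ∎
  where open ≤-Reasoning

slid-initial : ∀ n m → Slid 0 (initial n m)
slid-initial n m = tameCuts-initial n m , height≡0
  where
  height≡0 : phase 0 (replicate n b) (replicate m w) ≡ 0ℙ
  height≡0 rewrite whites-replicate-b n | blacks-replicate-w m = refl

-- Both colours must occur: with `n` equal to 2 and `m` equal to 0, a single jump suffices.
lower-bound : ∀ n m → 1 ≤ n → 1 ≤ m → initial n m —[ ops ]↠ final n m → n * m + n + m ≤ length ops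
lower-bound {ops} (suc n) (suc m) _ _ run = begin
  suc n * suc m + suc n + suc m                                ≡⟨ regroup (suc n * suc m) (suc n) (suc m) ⟩
  (suc m + suc n) + suc n * suc m                              ≡⟨ cong (suc m + suc n +_) (inversions-initial (suc n) (suc m)) ⟨
  (suc m + suc n) + inversionsᶜ (initial (suc n) (suc m))      ≤⟨ run-bound n m (slid-initial (suc n) (suc m)) run ⟩
  length ops + 0                                               ≡⟨ +-identityʳ _ ⟩
  length ops                                                   ∎
  where
  open ≤-Reasoning
  regroup : ∀ x y z → x + y + z ≡ (z + y) + x
  regroup = solve-∀

theorem2 : (n m : ℕ) → 1 ≤ m → m ≤ n → (d : Dir) →
    (initial n m —[ move n m d ]↠ final n m)
    × length (move n m d) ≡ n * m + n + m
    × ¬ (∃[ ops ] (initial n m —[ ops ]↠ final n m) × length ops < length (move n m d))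
theorem2 n m 1≤m m≤n d =
  legal , len ,
  λ (ops , run , shorter) →
    <⇒≱ shorter (≤-trans (≤-reflexive len) (lower-bound n m (≤-trans 1≤m m≤n) 1≤m run))
  where
  legal : initial n m —[ move n m d ]↠ final n m
  legal = subst (λ n → initial n m —[ move n m d ]↠ final n m) (m+[n∸m]≡n m≤n) (move-legal m (n ∸ m) d)
  len : length (move n m d) ≡ n * m + n + m
  len = subst (λ n → length (move n m d) ≡ n * m + n + m) (m+[n∸m]≡n m≤n) (length-move m (n ∸ m) d)
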